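{- Let $\lambda$ be a nonzero real number, $x$ real, and $n\ge0$ an integer. Then $$\beta_{n,\lambda}(x)=\sum_{j=0}^{n}\frac{\lambda^{j}(1)_{j+1,\frac{1}{\lambda}}}{j+1}\sum_{k=j}^{n}\binom{n}{k}S_{2,\lambda}(k,j)\,(x)_{n-k,\lambda}.$$
   Context: For real $y$, $\mu\neq 0$ and integer $k\ge0$: $(y)_{0,\mu}=1$, $(y)_{k,\mu}=y(y-\mu)\cdots(y-(k-1)\mu)$ (used with $\mu=\lambda$ and $\mu=1/\lambda$); $(y)_0=1$, $(y)_k=y(y-1)\cdots(y-k+1)$. The degenerate exponential is $e_\lambda^x(t)=\sum_{k\ge0}(x)_{k,\lambda}t^k/k!=(1+\lambda t)^{x/\lambda}$, $e_\lambda(t)=e^1_\lambda(t)$. The degenerate Bernoulli polynomials are defined by $\frac{t}{e_\lambda(t)-1}e_\lambda^x(t)=\sum_{n\ge0}\beta_{n,\lambda}(x)\frac{t^n}{n!}$. The degenerate Stirling numbers of the second kind are defined by $(x)_{n,\lambda}=\sum_{k=0}^{n}S_{2,\lambda}(n,k)(x)_{k}$ ($n\ge0$). -}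

module Defs where

open import Algebra.Bundles using (CommutativeRing)
import Algebra.Properties.CommutativeSemiring.Exp as Exp
import Algebra.Properties.Semiring.Mult as Mult
import Algebra.Properties.Semiring.Sum as Sum
open import Data.Fin.Base using (Fin; toℕ)
import Data.Fin.Properties as Finₚ
open import Data.List.Base using (List; []; _∷_)
open import Data.Nat.Base as ℕ using (ℕ; zero; suc; _∸_; _!)
import Data.Nat.Properties as ℕₚ
open import Data.Integer.Base as ℤ using (+_)
import Data.Integer.Properties as ℤₚ
open import Data.Product.Base using (∃; _×_; _,_)
open import Data.Rational.Base as ℚ using (ℚ; 0ℚ; 1ℚ; ½) hiding (module ℚ)
import Data.Rational.Properties as ℚₚ
import Data.Rational.Unnormalised.Base as ℚᵘ
import Data.Rational.Unnormalised.Properties as ℚᵘₚ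
open import Data.Rational.Solver using (module +-*-Solver)
open import Function.Base using (_∘_)
open import Level using (0ℓ)
open import Relation.Binary.PropositionalEquality as ≡ using (_≡_; refl; cong; cong₂; subst)
open import Relation.Nullary using (¬_; yes; no; contradiction)

Near : (ℕ → ℚ) → (ℕ → ℚ) → ℚ → Set
Near x y ε = ∃ λ N → ∀ m n → N ℕ.≤ m → N ℕ.≤ n → ℚ.∣ x m ℚ.- y n ∣ ℚ.< ε

-- A partial equivalence relation: x ~ x says that x is a Cauchy sequence,
-- and for Cauchy sequences x ~ y says that x and y have the same limit.
infix 4 _~_
_~_ : (ℕ → ℚ) → (ℕ → ℚ) → Set
x ~ y = ∀ ε → 0ℚ ℚ.< ε → Near x y ε

record ℝ : Set where
  no-eta-equality
  field
    seq    : ℕ → ℚ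
    cauchy : seq ~ seq
open ℝ public

infix 4 _≈_ _#_

record _≈_ (x y : ℝ) : Set where
  constructor mk≈
  field same-limit : seq x ~ seq y
open _≈_ public

-- Apartness: the positive form of x ≠ y, from which a reciprocal can be
-- computed.  It is tight (#-tight below), so classically it is exactly ¬ x ≈ y.
record _#_ (x y : ℝ) : Set where
  constructor mk#
  field
    gap       : ℚ
    gap>0     : 0ℚ ℚ.< gap
    from      : ℕ
    separated : ∀ m n → from ℕ.≤ m → from ℕ.≤ n → gap ℚ.≤ ℚ.∣ seq x m ℚ.- seq y n ∣

module SequenceLemmas where
  open ℚ using (_+_; _*_; -_; _-_; ∣_∣; _<_; _≤_; 1/_; positive; nonNegative; Positive; NonZero)
  open ℚₚ.≤-Reasoning

  half : ℚ → ℚ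
  half ε = ½ * ε

  half-pos : ∀ {ε} → 0ℚ < ε → 0ℚ < half ε
  half-pos {ε} p = subst (_< half ε) (ℚₚ.*-zeroʳ ½) (ℚₚ.*-monoʳ-<-pos ½ p)

  half+half : ∀ ε → half ε + half ε ≡ ε
  half+half = solve 1 (λ e → (con ½ :* e) :+ (con ½ :* e) := e) refl
    where open +-*-Solver

  ∣∣-swap : ∀ p q → ∣ p - q ∣ ≡ ∣ q - p ∣
  ∣∣-swap p q = ≡.trans (≡.sym (ℚₚ.∣-p∣≡∣p∣ (p - q)))
    (cong ∣_∣ (solve 2 (λ a b → :- (a :- b) := b :- a) refl p q))
    where open +-*-Solver

  ∣∣-triangle : ∀ p q r → ∣ p - r ∣ ≤ ∣ p - q ∣ + ∣ q - r ∣
  ∣∣-triangle p q r = begin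
    ∣ p - r ∣               ≡⟨ cong ∣_∣ (solve 3 (λ a b c → a :- c := (a :- b) :+ (b :- c)) refl p q r) ⟩
    ∣ (p - q) + (q - r) ∣   ≤⟨ ℚₚ.∣p+q∣≤∣p∣+∣q∣ (p - q) (q - r) ⟩
    ∣ p - q ∣ + ∣ q - r ∣   ∎
    where open +-*-Solver

  ∣∣-shift : ∀ p q → ∣ p ∣ ≤ ∣ q ∣ + ∣ p - q ∣
  ∣∣-shift p q = begin
    ∣ p ∣             ≡⟨ cong ∣_∣ (solve 2 (λ a b → a := b :+ (a :- b)) refl p q) ⟩
    ∣ q + (p - q) ∣   ≤⟨ ℚₚ.∣p+q∣≤∣p∣+∣q∣ q (p - q) ⟩
    ∣ q ∣ + ∣ p - q ∣ ∎
    where open +-*-Solver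

  0<1 : 0ℚ < 1ℚ
  0<1 = ℚₚ.positive⁻¹ 1ℚ

  *-mono-∣∣ : ∀ p q {a b} → ∣ p ∣ ≤ a → ∣ q ∣ ≤ b → ∣ p * q ∣ ≤ a * b
  *-mono-∣∣ p q {a} {b} p≤a q≤b = begin
    ∣ p * q ∣     ≡⟨ ℚₚ.∣p*q∣≡∣p∣*∣q∣ p q ⟩
    ∣ p ∣ * ∣ q ∣ ≤⟨ ℚₚ.*-monoʳ-≤-nonNeg ∣ q ∣ {{ℚₚ.∣-∣-nonNeg q}} p≤a ⟩
    a * ∣ q ∣     ≤⟨ ℚₚ.*-monoˡ-≤-nonNeg a {{nonNegative (ℚₚ.≤-trans (ℚₚ.0≤∣p∣ p) p≤a)}} q≤b ⟩
    a * b         ∎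

  rescale : ∀ B ε → 0ℚ < B → 0ℚ < ε → ∃ λ δ → (0ℚ < δ) × (B * δ ≡ ε)
  rescale B ε B>0 ε>0 = 1/B * ε , pos , eq
    where
    instance
      B-pos : Positive B
      B-pos = positive B>0
      B-nz : NonZero B
      B-nz = ℚₚ.pos⇒nonZero B
    1/B = 1/ B
    pos : 0ℚ < 1/B * ε
    pos = subst (_< 1/B * ε) (ℚₚ.*-zeroʳ 1/B) (ℚₚ.*-monoʳ-<-pos 1/B {{ℚₚ.1/pos⇒pos B}} ε>0)
    eq : B * (1/B * ε) ≡ ε
    eq = ≡.trans (≡.sym (ℚₚ.*-assoc B 1/B ε))
         (≡.trans (cong (_* ε) (ℚₚ.*-inverseʳ B)) (ℚₚ.*-identityˡ ε))

  ⊔-≤₁ : ∀ {a b m} → a ℕ.⊔ b ℕ.≤ m → a ℕ.≤ m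
  ⊔-≤₁ {a} {b} = ℕₚ.≤-trans (ℕₚ.m≤m⊔n a b)

  ⊔-≤₂ : ∀ {a b m} → a ℕ.⊔ b ℕ.≤ m → b ℕ.≤ m
  ⊔-≤₂ {a} {b} = ℕₚ.≤-trans (ℕₚ.m≤n⊔m a b)

  ~-const : ∀ q → (λ _ → q) ~ (λ _ → q)
  ~-const q ε ε>0 = 0 , λ _ _ _ _ → subst (_< ε) (≡.sym (cong ∣_∣ (ℚₚ.+-inverseʳ q))) ε>0

  ~-sym : ∀ {x y} → x ~ y → y ~ x
  ~-sym {x} {y} x~y ε ε>0 with x~y ε ε>0
  ... | N , h = N , λ m n N≤m N≤n → subst (_< ε) (∣∣-swap (x n) (y m)) (h n m N≤n N≤m)

  ~-trans : ∀ {x y z} → x ~ y → y ~ z → x ~ z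
  ~-trans {x} {y} {z} x~y y~z ε ε>0 =
    let (N , h) = x~y (half ε) (half-pos ε>0)
        (M , k) = y~z (half ε) (half-pos ε>0)
    in N ℕ.⊔ M , λ m n p q → let r = N ℕ.⊔ M in begin-strict
    ∣ x m - z n ∣                 ≤⟨ ∣∣-triangle (x m) (y r) (z n) ⟩
    ∣ x m - y r ∣ + ∣ y r - z n ∣ <⟨ ℚₚ.+-mono-< (h m r (⊔-≤₁ {N} {M} p) (ℕₚ.m≤m⊔n N M)) (k r n (ℕₚ.m≤n⊔m N M) (⊔-≤₂ {N} {M} q)) ⟩
    half ε + half ε               ≡⟨ half+half ε ⟩
    ε                             ∎

  ~-+ : ∀ {x x′ y y′} → x ~ x′ → y ~ y′ → (λ n → x n + y n) ~ (λ n → x′ n + y′ n)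
  ~-+ {x} {x′} {y} {y′} x~ y~ ε ε>0 =
    let (N , h) = x~ (half ε) (half-pos ε>0)
        (M , k) = y~ (half ε) (half-pos ε>0)
    in N ℕ.⊔ M , λ m n p q → begin-strict
    ∣ (x m + y m) - (x′ n + y′ n) ∣   ≡⟨ cong ∣_∣ (eq (x m) (y m) (x′ n) (y′ n)) ⟩
    ∣ (x m - x′ n) + (y m - y′ n) ∣   ≤⟨ ℚₚ.∣p+q∣≤∣p∣+∣q∣ (x m - x′ n) (y m - y′ n) ⟩
    ∣ x m - x′ n ∣ + ∣ y m - y′ n ∣   <⟨ ℚₚ.+-mono-< (h m n (⊔-≤₁ {N} {M} p) (⊔-≤₁ {N} {M} q)) (k m n (⊔-≤₂ {N} {M} p) (⊔-≤₂ {N} {M} q)) ⟩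
    half ε + half ε                   ≡⟨ half+half ε ⟩
    ε                                 ∎
    where
    open +-*-Solver
    eq : ∀ a b c d → (a + b) - (c + d) ≡ (a - c) + (b - d)
    eq = solve 4 (λ a b c d → (a :+ b) :- (c :+ d) := (a :- c) :+ (b :- d)) refl

  ~-neg : ∀ {x y} → x ~ y → (λ n → - x n) ~ (λ n → - y n)
  ~-neg {x} {y} x~y ε ε>0 with x~y ε ε>0
  ... | N , h = N , λ m n p q → subst (_< ε) (eq (x m) (y n)) (h m n p q)
    where
    open +-*-Solver
    eq : ∀ a b → ∣ a - b ∣ ≡ ∣ - a - - b ∣
    eq a b = ≡.trans (∣∣-swap a b) (cong ∣_∣ (solve 2 (λ a b → b :- a := :- a :- :- b) refl a b))

  bounded : ∀ {x y} → x ~ y → ∃ λ B → ∃ λ N → ∀ m → N ℕ.≤ m → ∣ x m ∣ ≤ B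
  bounded {x} {y} x~y with x~y 1ℚ 0<1
  ... | N , h = ∣ y N ∣ + 1ℚ , N , λ m p → begin
    ∣ x m ∣                 ≤⟨ ∣∣-shift (x m) (y N) ⟩
    ∣ y N ∣ + ∣ x m - y N ∣ ≤⟨ ℚₚ.+-monoʳ-≤ ∣ y N ∣ (ℚₚ.<⇒≤ (h m N p ℕₚ.≤-refl)) ⟩
    ∣ y N ∣ + 1ℚ            ∎

  p<p+q : ∀ p {q} → 0ℚ < q → p < p + q
  p<p+q p {q} q>0 = subst (_< p + q) (ℚₚ.+-identityʳ p) (ℚₚ.+-monoʳ-< p q>0)

  boundBy : ∀ {x y} → x ~ y → ∃ λ B → (0ℚ < B) × ∃ λ N → ∀ m → N ℕ.≤ m → ∣ x m ∣ ≤ B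
  boundBy {x} {y} x~y =
    let (B , N , h) = bounded {x} {y} x~y
        B<B+1 = p<p+q B {1ℚ} 0<1
    in B + 1ℚ , ℚₚ.≤-<-trans (ℚₚ.≤-trans (ℚₚ.0≤∣p∣ (x N)) (h N ℕₚ.≤-refl)) B<B+1
     , N , λ m p → ℚₚ.≤-trans (h m p) (ℚₚ.<⇒≤ B<B+1)

  ~-* : ∀ {x x′ y y′} → x ~ x′ → y ~ y′ → (λ n → x n * y n) ~ (λ n → x′ n * y′ n)
  ~-* {x} {x′} {y} {y′} x~ y~ ε ε>0 =
    let (B , B>0 , K , b) = boundBy {y} {y′} y~
        (C , C>0 , L , c) = boundBy {x′} {x} (~-sym {x} {x′} x~)
        (δ , δ>0 , Bδ) = rescale B (half ε) B>0 (half-pos ε>0)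
        (η , η>0 , Cη) = rescale C (half ε) C>0 (half-pos ε>0)
        (N , h) = x~ δ δ>0
        (M , k) = y~ η η>0
    in (K ℕ.⊔ L) ℕ.⊔ (N ℕ.⊔ M) , λ m n p q →
    let p₁ = ⊔-≤₁ {K ℕ.⊔ L} {N ℕ.⊔ M} p
        p₂ = ⊔-≤₂ {K ℕ.⊔ L} {N ℕ.⊔ M} p
        q₁ = ⊔-≤₁ {K ℕ.⊔ L} {N ℕ.⊔ M} q
        q₂ = ⊔-≤₂ {K ℕ.⊔ L} {N ℕ.⊔ M} q
    in begin-strict
    ∣ x m * y m - x′ n * y′ n ∣
      ≡⟨ cong ∣_∣ (eq (x m) (y m) (x′ n) (y′ n)) ⟩
    ∣ y m * (x m - x′ n) + x′ n * (y m - y′ n) ∣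
      ≤⟨ ℚₚ.∣p+q∣≤∣p∣+∣q∣ (y m * (x m - x′ n)) (x′ n * (y m - y′ n)) ⟩
    ∣ y m * (x m - x′ n) ∣ + ∣ x′ n * (y m - y′ n) ∣
      ≤⟨ ℚₚ.+-mono-≤ (*-mono-∣∣ (y m) (x m - x′ n) (b m (⊔-≤₁ {K} {L} p₁)) ℚₚ.≤-refl)
                     (*-mono-∣∣ (x′ n) (y m - y′ n) (c n (⊔-≤₂ {K} {L} q₁)) ℚₚ.≤-refl) ⟩
    B * ∣ x m - x′ n ∣ + C * ∣ y m - y′ n ∣
      <⟨ ℚₚ.+-mono-< (ℚₚ.*-monoʳ-<-pos B {{positive B>0}} (h m n (⊔-≤₁ {N} {M} p₂) (⊔-≤₁ {N} {M} q₂)))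
                     (ℚₚ.*-monoʳ-<-pos C {{positive C>0}} (k m n (⊔-≤₂ {N} {M} p₂) (⊔-≤₂ {N} {M} q₂))) ⟩
    B * δ + C * η
      ≡⟨ cong₂ _+_ Bδ Cη ⟩
    half ε + half ε
      ≡⟨ half+half ε ⟩
    ε ∎
    where
    open +-*-Solver
    eq : ∀ a b c d → a * b - c * d ≡ b * (a - c) + c * (b - d)
    eq = solve 4 (λ a b c d → a :* b :- c :* d := b :* (a :- c) :+ c :* (b :- d)) refl

  ~-≗ : ∀ {x y} → x ~ x → (∀ n → x n ≡ y n) → x ~ y
  ~-≗ {x} x~x eq ε ε>0 with x~x ε ε>0
  ... | N , h = N , λ m n p q → subst (λ z → ∣ x m - z ∣ < ε) (eq n) (h m n p q)

  recip : ℚ → ℚ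
  recip q with q ℚₚ.≟ 0ℚ
  ... | yes _   = 0ℚ
  ... | no q≢0  = (1/ q) {{ℚ.≢-nonZero q≢0}}

  recip-inverse : ∀ {δ} q → 0ℚ < δ → δ ≤ ∣ q ∣ → q * recip q ≡ 1ℚ
  recip-inverse {δ} q δ>0 δ≤q with q ℚₚ.≟ 0ℚ
  ... | yes refl = contradiction (ℚₚ.<-≤-trans δ>0 δ≤q) (ℚₚ.<-irrefl refl)
  ... | no q≢0   = ℚₚ.*-inverseʳ q {{ℚ.≢-nonZero q≢0}}

  recip-bound : ∀ {δ B} q → 0ℚ < δ → δ * B ≡ 1ℚ → δ ≤ ∣ q ∣ → ∣ recip q ∣ ≤ B
  recip-bound {δ} {B} q δ>0 δB δ≤q = ℚₚ.*-cancelˡ-≤-pos δ {{positive δ>0}} (begin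
    δ * ∣ recip q ∣       ≤⟨ ℚₚ.*-monoʳ-≤-nonNeg ∣ recip q ∣ {{ℚₚ.∣-∣-nonNeg (recip q)}} δ≤q ⟩
    ∣ q ∣ * ∣ recip q ∣   ≡⟨ ℚₚ.∣p*q∣≡∣p∣*∣q∣ q (recip q) ⟨
    ∣ q * recip q ∣       ≡⟨ cong ∣_∣ (recip-inverse q δ>0 δ≤q) ⟩
    1ℚ                    ≡⟨ δB ⟨
    δ * B                 ∎)

  module _ {x : ℕ → ℚ} (x~x : x ~ x) {δ} (δ>0 : 0ℚ < δ) (K : ℕ)
           (apart : ∀ m → K ℕ.≤ m → δ ≤ ∣ x m ∣) where

    ~-recip : (λ n → recip (x n)) ~ (λ n → recip (x n))
    ~-recip ε ε>0 =
      let (B , B>0 , δB) = rescale δ 1ℚ δ>0 0<1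
          (η , η>0 , Bη) = rescale B ε B>0 ε>0
          (θ , θ>0 , Bθ) = rescale B η B>0 η>0
          (N , h) = x~x θ θ>0
      in K ℕ.⊔ N , λ m n p q →
      let m≥K = ⊔-≤₁ {K} {N} p
          n≥K = ⊔-≤₁ {K} {N} q
          a = x m; b = x n; a′ = recip a; b′ = recip b
      in begin-strict
      ∣ a′ - b′ ∣
        ≡⟨ cong ∣_∣ (eq a b a′ b′ (recip-inverse a δ>0 (apart m m≥K)) (recip-inverse b δ>0 (apart n n≥K))) ⟩
      ∣ a′ * (b′ * (b - a)) ∣
        ≤⟨ *-mono-∣∣ a′ (b′ * (b - a)) (recip-bound a δ>0 δB (apart m m≥K))
             (*-mono-∣∣ b′ (b - a) (recip-bound b δ>0 δB (apart n n≥K)) ℚₚ.≤-refl) ⟩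
      B * (B * ∣ b - a ∣)
        <⟨ ℚₚ.*-monoʳ-<-pos B {{positive B>0}} (ℚₚ.*-monoʳ-<-pos B {{positive B>0}}
             (h n m (⊔-≤₂ {K} {N} q) (⊔-≤₂ {K} {N} p))) ⟩
      B * (B * θ)
        ≡⟨ cong (B *_) Bθ ⟩
      B * η
        ≡⟨ Bη ⟩
      ε ∎
      where
      open +-*-Solver
      eq : ∀ a b a′ b′ → a * a′ ≡ 1ℚ → b * b′ ≡ 1ℚ → a′ - b′ ≡ a′ * (b′ * (b - a))
      eq a b a′ b′ ea eb = ≡.sym (≡.trans
        (solve 4 (λ a b a′ b′ → a′ :* (b′ :* (b :- a)) := a′ :* (b :* b′) :- b′ :* (a :* a′)) refl a b a′ b′)
        (cong₂ _-_ (≡.trans (cong (a′ *_) eb) (ℚₚ.*-identityʳ a′)) (≡.trans (cong (b′ *_) ea) (ℚₚ.*-identityʳ b′))))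

    ~-recip-inverse : (λ n → x n * recip (x n)) ~ (λ _ → 1ℚ)
    ~-recip-inverse ε ε>0 = K , λ m n p q →
      subst (λ z → ∣ z - 1ℚ ∣ < ε) (≡.sym (recip-inverse (x m) δ>0 (apart m p))) ε>0

  tight : ∀ {x y} → x ~ x → y ~ y →
          ¬ (∃ λ δ → (0ℚ < δ) × ∃ λ K → ∀ m n → K ℕ.≤ m → K ℕ.≤ n → δ ≤ ∣ x m - y n ∣) → x ~ y
  tight {x} {y} x~x y~y not-apart ε ε>0 =
    decide (x~x η η>0) (y~y η η>0)
    where
    open +-*-Solver
    η = half (half (half ε))
    η>0 : 0ℚ < η
    η>0 = half-pos (half-pos (half-pos ε>0))
    η<2η : η < η + η
    η<2η = p<p+q η η>0
    decide : Near x x η → Near y y η → Near x y ε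
    decide (N , h) (M , k) with ∣ x (N ℕ.⊔ M) - y (N ℕ.⊔ M) ∣ ℚₚ.<? half ε
    ... | yes close = r , λ m n p q → begin-strict
      ∣ x m - y n ∣                                   ≤⟨ ∣∣-triangle (x m) (x r) (y n) ⟩
      ∣ x m - x r ∣ + ∣ x r - y n ∣                   ≤⟨ ℚₚ.+-monoʳ-≤ ∣ x m - x r ∣ (∣∣-triangle (x r) (y r) (y n)) ⟩
      ∣ x m - x r ∣ + (∣ x r - y r ∣ + ∣ y r - y n ∣) <⟨ ℚₚ.+-mono-< (h m r (⊔-≤₁ {N} {M} p) (ℕₚ.m≤m⊔n N M))
                                                           (ℚₚ.+-mono-< close (k r n (ℕₚ.m≤n⊔m N M) (⊔-≤₂ {N} {M} q))) ⟩
      η + (half ε + η)                                <⟨ ℚₚ.+-mono-< η<2η (ℚₚ.+-monoʳ-< (half ε) η<2η) ⟩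
      (η + η) + (half ε + (η + η))                    ≡⟨ solve 1 (λ e → let η = con ½ :* (con ½ :* (con ½ :* e)) in
                                                           (η :+ η) :+ (con ½ :* e :+ (η :+ η)) := e) refl ε ⟩
      ε                                               ∎
      where r = N ℕ.⊔ M
    ... | no ¬close = contradiction (η + η , ℚₚ.<-trans η>0 η<2η , r , far) not-apart
      where
      r = N ℕ.⊔ M
      far : ∀ m n → r ℕ.≤ m → r ℕ.≤ n → η + η ≤ ∣ x m - y n ∣
      far m n p q = begin
        η + η
          ≡⟨ solve 1 (λ e → let η = con ½ :* (con ½ :* (con ½ :* e)) in
               η :+ η := (:- (η :+ η)) :+ con ½ :* e) refl ε ⟩
        (- (η + η)) + half ε
          ≤⟨ ℚₚ.+-monoʳ-≤ (- (η + η)) (begin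
               half ε                                          ≤⟨ ℚₚ.≮⇒≥ ¬close ⟩
               ∣ x r - y r ∣                                   ≤⟨ ∣∣-triangle (x r) (x m) (y r) ⟩
               ∣ x r - x m ∣ + ∣ x m - y r ∣                   ≤⟨ ℚₚ.+-monoʳ-≤ ∣ x r - x m ∣ (∣∣-triangle (x m) (y n) (y r)) ⟩
               ∣ x r - x m ∣ + (∣ x m - y n ∣ + ∣ y n - y r ∣) ≤⟨ ℚₚ.+-mono-≤
                   (ℚₚ.<⇒≤ (h r m (ℕₚ.m≤m⊔n N M) (⊔-≤₁ {N} {M} p)))
                   (ℚₚ.+-monoʳ-≤ ∣ x m - y n ∣ (ℚₚ.<⇒≤ (k n r (⊔-≤₂ {N} {M} q) (ℕₚ.m≤n⊔m N M)))) ⟩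
               η + (∣ x m - y n ∣ + η)                         ∎) ⟩
        (- (η + η)) + (η + (∣ x m - y n ∣ + η))
          ≡⟨ solve 2 (λ η d → (:- (η :+ η)) :+ (η :+ (d :+ η)) := d) refl η ∣ x m - y n ∣ ⟩
        ∣ x m - y n ∣ ∎

open SequenceLemmas

fromℚ : ℚ → ℝ
fromℚ q .seq _  = q
fromℚ q .cauchy = ~-const q

0ℝ 1ℝ : ℝ
0ℝ = fromℚ 0ℚ
1ℝ = fromℚ 1ℚ

infixl 6 _+_
infixl 7 _*_
infix  8 -_

_+_ _*_ : ℝ → ℝ → ℝ
(x + y) .seq n  = seq x n ℚ.+ seq y n
(x + y) .cauchy = ~-+ {seq x} {seq x} {seq y} {seq y} (cauchy x) (cauchy y)
(x * y) .seq n  = seq x n ℚ.* seq y n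
(x * y) .cauchy = ~-* {seq x} {seq x} {seq y} {seq y} (cauchy x) (cauchy y)

-_ : ℝ → ℝ
(- x) .seq n  = ℚ.- seq x n
(- x) .cauchy = ~-neg {seq x} {seq x} (cauchy x)

pointwise : ∀ {x y} → (∀ n → seq x n ≡ seq y n) → x ≈ y
pointwise {x} {y} eq = mk≈ (~-≗ {seq x} {seq y} (cauchy x) eq)

ℝ-commutativeRing : CommutativeRing 0ℓ 0ℓ
ℝ-commutativeRing = record
  { Carrier = ℝ
  ; _≈_     = _≈_
  ; _+_     = _+_
  ; _*_     = _*_
  ; -_      = -_
  ; 0#      = 0ℝ
  ; 1#      = 1ℝ
  ; isCommutativeRing = record
    { isRing = record
      { +-isAbelianGroup = record
        { isGroup = record
          { isMonoid = record
            { isSemigroup = record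
              { isMagma = record
                { isEquivalence = record
                  { refl  = λ {x} → mk≈ (cauchy x)
                  ; sym   = λ {x} {y} p → mk≈ (~-sym {seq x} {seq y} (same-limit p))
                  ; trans = λ {x} {y} {z} p q →
                      mk≈ (~-trans {seq x} {seq y} {seq z} (same-limit p) (same-limit q))
                  }
                ; ∙-cong = λ {x} {x′} {y} {y′} p q →
                    mk≈ (~-+ {seq x} {seq x′} {seq y} {seq y′} (same-limit p) (same-limit q))
                }
              ; assoc = λ x y z → pointwise {(x + y) + z} {x + (y + z)}
                                    λ n → ℚₚ.+-assoc (seq x n) (seq y n) (seq z n)
              }
            ; identity = (λ x → pointwise {0ℝ + x} {x} λ n → ℚₚ.+-identityˡ (seq x n))
                       , (λ x → pointwise {x + 0ℝ} {x} λ n → ℚₚ.+-identityʳ (seq x n))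
            }
          ; inverse = (λ x → pointwise {(- x) + x} {0ℝ} λ n → ℚₚ.+-inverseˡ (seq x n))
                    , (λ x → pointwise {x + (- x)} {0ℝ} λ n → ℚₚ.+-inverseʳ (seq x n))
          ; ⁻¹-cong = λ {x} {y} p → mk≈ (~-neg {seq x} {seq y} (same-limit p))
          }
        ; comm = λ x y → pointwise {x + y} {y + x} λ n → ℚₚ.+-comm (seq x n) (seq y n)
        }
      ; *-cong = λ {x} {x′} {y} {y′} p q →
          mk≈ (~-* {seq x} {seq x′} {seq y} {seq y′} (same-limit p) (same-limit q))
      ; *-assoc = λ x y z → pointwise {(x * y) * z} {x * (y * z)}
                              λ n → ℚₚ.*-assoc (seq x n) (seq y n) (seq z n)
      ; *-identity = (λ x → pointwise {1ℝ * x} {x} λ n → ℚₚ.*-identityˡ (seq x n))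
                   , (λ x → pointwise {x * 1ℝ} {x} λ n → ℚₚ.*-identityʳ (seq x n))
      ; distrib = (λ x y z → pointwise {x * (y + z)} {(x * y) + (x * z)}
                               λ n → ℚₚ.*-distribˡ-+ (seq x n) (seq y n) (seq z n))
                , (λ x y z → pointwise {(y + z) * x} {(y * x) + (z * x)}
                               λ n → ℚₚ.*-distribʳ-+ (seq x n) (seq y n) (seq z n))
      }
    ; *-comm = λ x y → pointwise {x * y} {y * x} λ n → ℚₚ.*-comm (seq x n) (seq y n)
    }
  }

module ℝ-Ring = CommutativeRing ℝ-commutativeRing
open ℝ-Ring public using (_-_)
open Exp ℝ-Ring.commutativeSemiring public using (_^_)
open Mult ℝ-Ring.semiring using () renaming (_×_ to _·_)
open Sum ℝ-Ring.semiring using (sum; sum-cong-≋; sum-init-last; ∑-distrib-+; *-distribʳ-sum)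

#-tight : ∀ {x y} → ¬ (x # y) → x ≈ y
#-tight {x} {y} ¬x#y = mk≈ (tight {seq x} {seq y} (cauchy x) (cauchy y)
  λ (δ , δ>0 , K , h) → ¬x#y (mk# δ δ>0 K h))

#0-away : ∀ {x} (x#0 : x # 0ℝ) → let open _#_ x#0 in
          ∀ m → from ℕ.≤ m → gap ℚ.≤ ℚ.∣ seq x m ∣
#0-away {x} x#0 m p = subst (λ z → gap ℚ.≤ ℚ.∣ z ∣) (ℚₚ.+-identityʳ (seq x m)) (separated m m p p)
  where open _#_ x#0

inv : (x : ℝ) → x # 0ℝ → ℝ
inv x x#0 .seq n  = recip (seq x n)
inv x x#0 .cauchy = ~-recip {seq x} (cauchy x) gap>0 from (#0-away x#0)
  where open _#_ x#0

inv-inverseʳ : ∀ x (x#0 : x # 0ℝ) → x * inv x x#0 ≈ 1ℝ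
inv-inverseʳ x x#0 = mk≈ (~-recip-inverse {seq x} (cauchy x) gap>0 from (#0-away x#0))
  where open _#_ x#0

fromℕ : ℕ → ℝ
fromℕ n = n · 1ℝ

1/ℕ : (n : ℕ) .{{_ : ℕ.NonZero n}} → ℝ
1/ℕ n = fromℚ (+ 1 ℚ./ n)

fromℕ-seq : ∀ n k → seq (fromℕ n) k ≡ + n ℚ./ 1
fromℕ-seq zero    k = refl
fromℕ-seq (suc n) k = ≡.trans (cong (1ℚ ℚ.+_) (fromℕ-seq n k)) (ℚₚ.toℚᵘ-injective (begin-equality
  ℚ.toℚᵘ (1ℚ ℚ.+ (+ n ℚ./ 1))       ≃⟨ ℚₚ.toℚᵘ-homo-+ 1ℚ (+ n ℚ./ 1) ⟩
  ℚᵘ.1ℚᵘ ℚᵘ.+ ℚ.toℚᵘ (+ n ℚ./ 1)    ≃⟨ ℚᵘₚ.+-congʳ ℚᵘ.1ℚᵘ (ℚₚ.toℚᵘ-fromℚᵘ (ℚᵘ.mkℚᵘ (+ n) 0)) ⟩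
  ℚᵘ.1ℚᵘ ℚᵘ.+ ℚᵘ.mkℚᵘ (+ n) 0       ≃⟨ ℚᵘ.*≡* (cong (λ z → (+ 1 ℤ.+ z) ℤ.* + 1) (ℤₚ.*-identityʳ (+ n))) ⟩
  ℚᵘ.mkℚᵘ (+ suc n) 0               ≃⟨ ℚₚ.toℚᵘ-fromℚᵘ (ℚᵘ.mkℚᵘ (+ suc n) 0) ⟨
  ℚ.toℚᵘ (+ suc n ℚ./ 1)            ∎))
  where open ℚᵘₚ.≤-Reasoning

n/1*1/n : ∀ m → (+ suc m ℚ./ 1) ℚ.* (+ 1 ℚ./ suc m) ≡ 1ℚ
n/1*1/n m = inverse (ℚᵘ.mkℚᵘ (+ suc m) 0) (ℚᵘ.mkℚᵘ (+ 1) m) (ℚᵘₚ.*-inverseʳ (ℚᵘ.mkℚᵘ (+ suc m) 0))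
  where
  open ℚᵘₚ.≤-Reasoning
  inverse : ∀ p q → p ℚᵘ.* q ℚᵘ.≃ ℚᵘ.1ℚᵘ → ℚ.fromℚᵘ p ℚ.* ℚ.fromℚᵘ q ≡ 1ℚ
  inverse p q eq = ℚₚ.toℚᵘ-injective (begin-equality
    ℚ.toℚᵘ (ℚ.fromℚᵘ p ℚ.* ℚ.fromℚᵘ q)              ≃⟨ ℚₚ.toℚᵘ-homo-* (ℚ.fromℚᵘ p) (ℚ.fromℚᵘ q) ⟩
    ℚ.toℚᵘ (ℚ.fromℚᵘ p) ℚᵘ.* ℚ.toℚᵘ (ℚ.fromℚᵘ q)    ≃⟨ ℚᵘₚ.*-cong (ℚₚ.toℚᵘ-fromℚᵘ p) (ℚₚ.toℚᵘ-fromℚᵘ q) ⟩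
    p ℚᵘ.* q                                        ≃⟨ eq ⟩
    ℚᵘ.1ℚᵘ                                          ∎)

fromℕ-1/ℕ : ∀ n .{{_ : ℕ.NonZero n}} → fromℕ n * 1/ℕ n ≈ 1ℝ
fromℕ-1/ℕ (suc m) = times-constant (fromℕ (suc m)) {+ suc m ℚ./ 1} {+ 1 ℚ./ suc m} (fromℕ-seq (suc m)) (n/1*1/n m)
  where
  times-constant : ∀ x {p q} → (∀ k → seq x k ≡ p) → p ℚ.* q ≡ 1ℚ → x * fromℚ q ≈ 1ℝ
  times-constant x {p} {q} eq pq = pointwise {x * fromℚ q} {1ℝ} λ k → ≡.trans (cong (ℚ._* q) (eq k)) pq

-- The sum of f k over a ≤ k ≤ b (zero if b < a).
sumFromTo : ℕ → ℕ → (ℕ → ℝ) → ℝ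
sumFromTo a b f = sum {suc b ∸ a} (λ i → f (a ℕ.+ toℕ i))

infixl 10 sumFromTo
syntax sumFromTo a b (λ k → e) = ∑[ k from a to b ] e

infix 9 _⟦_⟧ _⟦_∣_⟧

_⟦_⟧ : ℝ → ℕ → ℝ
y ⟦ zero ⟧  = 1ℝ
y ⟦ suc k ⟧ = y ⟦ k ⟧ * (y - fromℕ k)

-- y ⟦ k ∣ μ ⟧ = y (y - μ) ⋯ (y - (k - 1) μ)
_⟦_∣_⟧ : ℝ → ℕ → ℝ → ℝ
y ⟦ zero ∣ μ ⟧  = 1ℝ
y ⟦ suc k ∣ μ ⟧ = y ⟦ k ∣ μ ⟧ * (y - fromℕ k * μ)

-- Formal power series in t, as coefficient sequences.
Series : Set
Series = ℕ → ℝ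

1ˢ tˢ : Series
1ˢ zero          = 1ℝ
1ˢ (suc n)       = 0ℝ
tˢ (suc zero)    = 1ℝ
tˢ zero          = 0ℝ
tˢ (suc (suc n)) = 0ℝ

infixl 6 _⊖_
infixl 7 _⊛_

_⊖_ _⊛_ : Series → Series → Series
(f ⊖ g) n = f n - g n
(f ⊛ g) n = ∑[ k from 0 to n ] (f k * g (n ∸ k))

dot : Series → List ℝ → ℝ
dot w []       = 0ℝ
dot w (c ∷ cs) = w 0 * c + dot (w ∘ suc) cs

-- 1 / u for a series u with constant term 1: the coefficients are
-- c₀ = 1 and cₙ₊₁ = - (u₁ cₙ + u₂ cₙ₋₁ + ⋯ + uₙ₊₁ c₀).
mutual
  reciprocal : Series → Series
  reciprocal u zero    = 1ℝ
  reciprocal u (suc n) = - dot (u ∘ suc) (initial u n)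

  initial : Series → ℕ → List ℝ
  initial u zero    = reciprocal u zero ∷ []
  initial u (suc n) = reciprocal u (suc n) ∷ initial u n

-- t / f for a series f = t (1 + ⋯); see t-over-spec.
t-over : Series → Series
t-over f = reciprocal (f ∘ suc)

module _ where
  open ℝ-Ring using (+-cong; +-congˡ; *-congʳ; zeroˡ; *-identityˡ; *-identityʳ;
    +-identityˡ; +-identityʳ; -‿inverseˡ; setoid)
    renaming (refl to ≈-refl; sym to ≈-sym; trans to ≈-trans)
  open import Relation.Binary.Reasoning.Setoid setoid

  dot-initial : ∀ u n w → dot w (initial u n) ≈ ∑[ k from 0 to n ] (w k * reciprocal u (n ∸ k))
  dot-initial u zero    w = ≈-refl
  dot-initial u (suc n) w = +-congˡ (dot-initial u n (w ∘ suc))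

  reciprocal-inverse : ∀ u → u 0 ≈ 1ℝ → ∀ n → (u ⊛ reciprocal u) n ≈ 1ˢ n
  reciprocal-inverse u u₀ zero = ≈-trans (+-identityʳ _) (≈-trans (*-identityʳ _) u₀)
  reciprocal-inverse u u₀ (suc n) = begin
    u 0 * reciprocal u (suc n) + _
      ≈⟨ +-cong (≈-trans (*-congʳ u₀) (*-identityˡ _)) (≈-sym (dot-initial u n (u ∘ suc))) ⟩
    reciprocal u (suc n) + dot (u ∘ suc) (initial u n)
      ≈⟨ -‿inverseˡ _ ⟩
    0ℝ ∎

  t-over-spec : ∀ f → f 0 ≈ 0ℝ → f 1 ≈ 1ℝ → ∀ n → (f ⊛ t-over f) n ≈ tˢ n
  t-over-spec f f₀ f₁ zero = ≈-trans (+-identityʳ _) (≈-trans (*-identityʳ _) f₀)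
  t-over-spec f f₀ f₁ (suc n) = begin
    f 0 * t-over f (suc n) + _  ≈⟨ +-cong (≈-trans (*-congʳ f₀) (zeroˡ _)) (reciprocal-inverse (f ∘ suc) f₁ n) ⟩
    0ℝ + 1ˢ n                   ≈⟨ +-identityˡ _ ⟩
    1ˢ n                        ≈⟨ shift n ⟩
    tˢ (suc n)                  ∎
    where
    shift : ∀ n → 1ˢ n ≈ tˢ (suc n)
    shift zero    = ≈-refl
    shift (suc n) = ≈-refl

-- The exponential e_ƛ^x(t) = Σₖ (x)ₖ,ƛ tᵏ / k! as a formal power series.
e : ℝ → ℝ → Series
e ƛ x k = x ⟦ k ∣ ƛ ⟧ * 1/ℕ (k !) {{ℕₚ._!≢0 k}}

-- β ƛ n x is n! times the coefficient of tⁿ in t / (e ƛ 1 - 1) · e ƛ x.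
β : ℝ → ℕ → ℝ → ℝ
β ƛ n x = fromℕ (n !) * (t-over (e ƛ 1ℝ ⊖ 1ˢ) ⊛ e ƛ x) n

IsDegenerateStirling₂ : ℝ → (ℕ → ℕ → ℝ) → Set
IsDegenerateStirling₂ ƛ S = ∀ n x → x ⟦ n ∣ ƛ ⟧ ≈ ∑[ k from 0 to n ] (S n k * x ⟦ k ⟧)

module _ (ƛ : ℝ) where
  open ℝ-Ring using (+-cong; +-congˡ; +-congʳ; +-assoc; +-comm; *-congʳ; *-congˡ; *-assoc;
    zeroˡ; distribˡ; distribʳ; *-identityˡ; *-identityʳ;
    +-identityˡ; +-identityʳ; -‿inverseˡ; -‿inverseʳ; -‿cong; setoid)
    renaming (refl to ≈-refl; sym to ≈-sym; trans to ≈-trans)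
  open import Relation.Binary.Reasoning.Setoid setoid
  open import Algebra.Properties.CommutativeSemigroup ℝ-Ring.*-commutativeSemigroup using (xy∙z≈xz∙y)
  open import Algebra.Properties.Ring ℝ-Ring.ring using (-0#≈0#)

  minus-zero : ∀ {x y} → y ≈ 0ℝ → x - y ≈ x
  minus-zero y≈0 = ≈-trans (+-congˡ (≈-trans (-‿cong y≈0) -0#≈0#)) (+-identityʳ _)

  t-over-e-1 : ∀ n → ((e ƛ 1ℝ ⊖ 1ˢ) ⊛ t-over (e ƛ 1ℝ ⊖ 1ˢ)) n ≈ tˢ n
  t-over-e-1 = t-over-spec (e ƛ 1ℝ ⊖ 1ˢ)
    (≈-trans (+-congʳ (*-identityˡ _)) (-‿inverseʳ _))
    (≈-trans (minus-zero ≈-refl) (≈-trans (*-identityʳ _) (≈-trans (*-identityˡ _) (minus-zero (zeroˡ _)))))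

  stirling₂ : ℕ → ℕ → ℝ
  stirling₂ zero    zero    = 1ℝ
  stirling₂ zero    (suc k) = 0ℝ
  stirling₂ (suc n) zero    = stirling₂ n zero * (fromℕ zero - fromℕ n * ƛ)
  stirling₂ (suc n) (suc k) = stirling₂ n k + stirling₂ n (suc k) * (fromℕ (suc k) - fromℕ n * ƛ)

  stirling₂-zero : ∀ n k → n ℕ.< k → stirling₂ n k ≈ 0ℝ
  stirling₂-zero zero    (suc k) _           = ≈-refl
  stirling₂-zero (suc n) (suc k) (ℕ.s≤s n<k) =
    ≈-trans (+-cong (stirling₂-zero n k n<k)
                    (≈-trans (*-congʳ (stirling₂-zero n (suc k) (ℕₚ.m<n⇒m<1+n n<k))) (zeroˡ _)))
            (+-identityʳ _)

  -- IsDegenerateStirling₂ is satisfiable: the usual recurrence gives a solution.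
  stirling₂-isDegenerateStirling₂ : IsDegenerateStirling₂ ƛ stirling₂
  stirling₂-isDegenerateStirling₂ zero    x = ≈-sym (≈-trans (+-identityʳ _) (*-identityʳ _))
  stirling₂-isDegenerateStirling₂ (suc n) x = begin
    x ⟦ n ∣ ƛ ⟧ * d
      ≈⟨ *-congʳ (stirling₂-isDegenerateStirling₂ n x) ⟩
    sum (a ∘ toℕ {suc n}) * d
      ≈⟨ *-distribʳ-sum d (a ∘ toℕ {suc n}) ⟩
    sum (λ (i : Fin (suc n)) → a (toℕ i) * d)
      ≈⟨ sum-cong-≋ {suc n} (λ i → split (toℕ i)) ⟩
    sum (λ (i : Fin (suc n)) → u (toℕ i) + v (toℕ i))
      ≈⟨ ∑-distrib-+ (u ∘ toℕ {suc n}) (v ∘ toℕ) ⟩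
    sum (u ∘ toℕ {suc n}) + sum (v ∘ toℕ {suc n})
      ≈⟨ +-congˡ extend ⟩
    sum (u ∘ toℕ {suc n}) + (v 0 + sum (v ∘ suc ∘ toℕ {suc n}))
      ≈⟨ ≈-trans (≈-sym (+-assoc _ _ _)) (≈-trans (+-congʳ (+-comm _ _)) (+-assoc _ _ _)) ⟩
    v 0 + (sum (u ∘ toℕ {suc n}) + sum (v ∘ suc ∘ toℕ {suc n}))
      ≈⟨ +-congˡ (≈-sym (∑-distrib-+ (u ∘ toℕ {suc n}) (v ∘ suc ∘ toℕ))) ⟩
    v 0 + sum (λ (i : Fin (suc n)) → u (toℕ i) + v (suc (toℕ i)))
      ≈⟨ +-congˡ (sum-cong-≋ {suc n} (λ i → ≈-sym (join (toℕ i)))) ⟩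
    v 0 + sum (λ (i : Fin (suc n)) → stirling₂ (suc n) (suc (toℕ i)) * x ⟦ suc (toℕ i) ⟧)
      ∎
    where
    d : ℝ
    d = x - fromℕ n * ƛ
    a u v : ℕ → ℝ
    a k = stirling₂ n k * x ⟦ k ⟧
    u k = stirling₂ n k * x ⟦ suc k ⟧
    v k = stirling₂ n k * (fromℕ k - fromℕ n * ƛ) * x ⟦ k ⟧
    telescope : ∀ p q r → p - r ≈ (p - q) + (q - r)
    telescope p q r = ≈-sym (≈-trans (+-assoc _ _ _)
      (+-congˡ (≈-trans (≈-sym (+-assoc _ _ _)) (≈-trans (+-congʳ (-‿inverseˡ q)) (+-identityˡ _)))))
    split : ∀ k → a k * d ≈ u k + v k
    split k = ≈-trans (*-congˡ (telescope x (fromℕ k) (fromℕ n * ƛ)))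
      (≈-trans (distribˡ _ _ _) (+-cong (*-assoc _ _ _) (xy∙z≈xz∙y _ _ _)))
    join : ∀ k → stirling₂ (suc n) (suc k) * x ⟦ suc k ⟧ ≈ u k + v (suc k)
    join k = distribʳ (x ⟦ suc k ⟧) (stirling₂ n k) (stirling₂ n (suc k) * (fromℕ (suc k) - fromℕ n * ƛ))
    extend : sum (v ∘ toℕ {suc n}) ≈ sum (v ∘ toℕ {suc (suc n)})
    extend = ≈-sym (≈-trans (sum-init-last (v ∘ toℕ {suc (suc n)})) (≈-trans
      (+-cong (sum-cong-≋ {suc n} (λ i → ℝ-Ring.reflexive (cong v (Finₚ.toℕ-inject₁ i))))
              (≈-trans (ℝ-Ring.reflexive (cong v (Finₚ.toℕ-fromℕ (suc n))))
                (≈-trans (*-congʳ (≈-trans (*-congʳ (stirling₂-zero n (suc n) ℕₚ.≤-refl)) (zeroˡ _))) (zeroˡ _))))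
      (+-identityʳ _)))

{-# OPTIONS --safe #-}

-- Let c j = ƛ^j (1)_{j+1,1/ƛ} / (j+1) and let L be the linear functional on
-- polynomials in y with L((y)_j) = c j.  Applied to e_ƛ^y(t) it gives the
-- series B(t) with coefficients Σ_j S(k,j) c j / k!, and
-- (e_ƛ(t) - 1) B(t) = L(Δ e_ƛ^y(t)).  Since L(Δ (y)_{j+1}) = (j+1) c j =
-- (ƛ)_{j+1} / ƛ, one has ƛ L(Δ p) = p(ƛ) - p(0) for every polynomial p, so
-- ƛ (e_ƛ(t) - 1) B(t) = e_ƛ^ƛ(t) - 1 = ƛ t.  Hence B(t) = t / (e_ƛ(t) - 1),
-- and multiplying by e_ƛ^x(t) gives the formula.  In coordinates, the action
-- of the shift y ↦ y + 1 on the basis (y)_j is the identity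
-- Σ_k C(n,k) (1)_{k,ƛ} S(n-k,j) = S(n,j) + (j+1) S(n,j+1).
module Submission where

open import Defs
import Algebra.Properties.AbelianGroup ℝ-Ring.+-abelianGroup as Additive
import Algebra.Properties.Ring ℝ-Ring.ring as Ringₚ
import Algebra.Properties.Semiring.Mult ℝ-Ring.semiring as Mult
import Algebra.Properties.Semiring.Sum ℝ-Ring.semiring as Sum
open import Algebra.Solver.Ring.NaturalCoefficients.Default ℝ-Ring.commutativeSemiring
  using (solve; con; _:+_; _:*_; _:=_)
open import Data.Fin.Base using (toℕ)
open import Data.Nat.Base as ℕ using (ℕ; zero; suc; _∸_; _!; _≤_; _<_; z≤n; s≤s; z<s; s<s)
open import Data.Nat.Combinatorics using (_C_; nCk≡n!/k![n-k]!; k![n∸k]!∣n!; nCk+nC[k+1]≡[n+1]C[k+1]; k>n⇒nCk≡0)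
open import Data.Nat.DivMod using (m/n*n≡m)
open import Data.Nat.Induction using (<-rec)
import Data.Nat.Properties as ℕₚ
open import Function.Base using (_∘_)
open import Relation.Binary.PropositionalEquality as ≡ using (_≡_; cong)
open ℝ-Ring using (+-cong; +-congˡ; +-congʳ; +-comm; +-identityˡ; +-identityʳ;
  *-cong; *-congˡ; *-congʳ; *-assoc; *-comm; *-identityˡ; *-identityʳ; zeroˡ; zeroʳ;
  distribˡ; distribʳ; -‿cong; -‿inverseʳ; reflexive; setoid)
  renaming (refl to ≈-refl; sym to ≈-sym; trans to ≈-trans)
open import Relation.Binary.Reasoning.Setoid setoid

-- Finite sums

∑< : ℕ → (ℕ → ℝ) → ℝ
∑< n f = Sum.sum {n} (λ i → f (toℕ i))

infixl 10 ∑<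
syntax ∑< n (λ k → e) = ∑[ k < n ] e

∑-cong : ∀ n {f g} → (∀ k → k < n → f k ≈ g k) → ∑< n f ≈ ∑< n g
∑-cong zero    f≈g = ≈-refl
∑-cong (suc n) f≈g = +-cong (f≈g 0 z<s) (∑-cong n λ k k<n → f≈g (suc k) (s<s k<n))

∑-zero : ∀ n {f} → (∀ k → k < n → f k ≈ 0ℝ) → ∑< n f ≈ 0ℝ
∑-zero n f≈0 = ≈-trans (∑-cong n f≈0) (Sum.sum-replicate-zero n)

∑-+ : ∀ n f g → ∑[ k < n ] (f k + g k) ≈ ∑< n f + ∑< n g
∑-+ n f g = Sum.∑-distrib-+ {n} (f ∘ toℕ) (g ∘ toℕ)

*-∑ : ∀ n c f → c * ∑< n f ≈ ∑[ k < n ] (c * f k)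
*-∑ n c f = Sum.*-distribˡ-sum {n} c (f ∘ toℕ)

∑-comm : ∀ m n (f : ℕ → ℕ → ℝ) → ∑[ i < m ] (∑[ j < n ] f i j) ≈ ∑[ j < n ] (∑[ i < m ] f i j)
∑-comm m n f = Sum.∑-comm {m} {n} (λ i j → f (toℕ i) (toℕ j))

∑-extend : ∀ {m n} f → m ≤ n → (∀ k → m ≤ k → f k ≈ 0ℝ) → ∑< m f ≈ ∑< n f
∑-extend {n = n} f z≤n f≈0 = ≈-sym (∑-zero n λ k _ → f≈0 k z≤n)
∑-extend f (s≤s m≤n) f≈0 = +-congˡ (∑-extend (f ∘ suc) m≤n λ k m≤k → f≈0 (suc k) (s≤s m≤k))

-- This trims a full convolution to the range `j ≤ k ≤ n` of the inner sum. If `j` exceeds the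
-- range, truncated subtraction empties the left side and the hypothesis kills the right.
∑-drop : ∀ j n f → (∀ k → k < j → f k ≈ 0ℝ) → ∑[ i < n ∸ j ] f (j ℕ.+ i) ≈ ∑< n f
∑-drop zero    n       f f≈0 = ≈-refl
∑-drop (suc j) zero    f f≈0 = ≈-refl
∑-drop (suc j) (suc n) f f≈0 = begin
  ∑[ i < n ∸ j ] f (suc j ℕ.+ i)  ≈⟨ ∑-drop j n (f ∘ suc) (λ k k<j → f≈0 (suc k) (s<s k<j)) ⟩
  ∑< n (f ∘ suc)                  ≈⟨ +-identityˡ _ ⟨
  0ℝ + ∑< n (f ∘ suc)             ≈⟨ +-congʳ (f≈0 0 z<s) ⟨
  ∑< (suc n) f                    ∎

-- Cancellation and embedded naturals

cancel-unit : ∀ {u v y z} → u * v ≈ 1ℝ → u * y ≈ u * z → y ≈ z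
cancel-unit {u} {v} {y} {z} uv≈1 eq = begin
  y            ≈⟨ unfold y ⟨
  v * (u * y)  ≈⟨ *-congˡ eq ⟩
  v * (u * z)  ≈⟨ unfold z ⟩
  z            ∎
  where
  unfold : ∀ w → v * (u * w) ≈ w
  unfold w = begin
    v * (u * w)  ≈⟨ solve 3 (λ u v w → v :* (u :* w) := u :* v :* w) ≈-refl u v w ⟩
    u * v * w    ≈⟨ *-congʳ uv≈1 ⟩
    1ℝ * w       ≈⟨ *-identityˡ w ⟩
    w            ∎

fromℕ-+ : ∀ m n → fromℕ (m ℕ.+ n) ≈ fromℕ m + fromℕ n
fromℕ-+ = Mult.×-homo-+ 1ℝ

fromℕ-* : ∀ m n → fromℕ (m ℕ.* n) ≈ fromℕ m * fromℕ n
fromℕ-* = Mult.×1-homo-*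

x-0*y≈x : ∀ x y → x - fromℕ 0 * y ≈ x
x-0*y≈x x y = minus-zero y (zeroˡ y)

[x+y]-[x+z]≈y-z : ∀ x y z → (x + y) - (x + z) ≈ y - z
[x+y]-[x+z]≈y-z x y z = begin
  x + y + - (x + z)      ≈⟨ +-congˡ (Additive.⁻¹-∙-comm x z) ⟨
  x + y + (- x + - z)    ≈⟨ solve 4 (λ p q r s → p :+ q :+ (r :+ s) := p :+ r :+ (q :+ s)) ≈-refl x y (- x) (- z) ⟩
  x + - x + (y + - z)    ≈⟨ +-congʳ (-‿inverseʳ x) ⟩
  0ℝ + (y + - z)         ≈⟨ +-identityˡ _ ⟩
  y - z                  ∎

-- Factorials and binomial coefficients

1/! : ℕ → ℝ
1/! n = 1/ℕ (n !) {{n ℕₚ.!≢0}}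

!-1/! : ∀ n → fromℕ (n !) * 1/! n ≈ 1ℝ
!-1/! n = fromℕ-1/ℕ (n !) {{n ℕₚ.!≢0}}

!≡C*!*! : ∀ {n k} → k ≤ n → n ! ≡ (n C k) ℕ.* (k ! ℕ.* (n ∸ k) !)
!≡C*!*! {n} {k} k≤n = ≡.sym (≡.trans
  (cong (ℕ._* (k ! ℕ.* (n ∸ k) !)) (nCk≡n!/k![n-k]! k≤n))
  (m/n*n≡m {{ℕₚ._!*_!≢0 k (n ∸ k)}} (k![n∸k]!∣n! k≤n)))

-- Binomial convolution

⋆-term : (ℕ → ℝ) → (ℕ → ℝ) → ℕ → ℕ → ℝ
⋆-term a b n k = fromℕ (n C k) * (a k * b (n ∸ k))

_⋆_ : (ℕ → ℝ) → (ℕ → ℝ) → ℕ → ℝ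
(a ⋆ b) n = ∑< (suc n) (⋆-term a b n)

infixl 7 _⋆_

⋆-zero : ∀ a b → (a ⋆ b) 0 ≈ a 0 * b 0
⋆-zero a b = solve 1 (λ p → (con 1 :+ con 0) :* p :+ con 0 := p) ≈-refl (a 0 * b 0)

-- The Leibniz rule: shifting a sequence differentiates its exponential generating function.
-- Pascal's rule splits each binomial coefficient.
⋆-suc : ∀ a b n → (a ⋆ b) (suc n) ≈ (a ∘ suc ⋆ b) n + (a ⋆ (b ∘ suc)) n
⋆-suc a b n = begin
  h 0 + ∑[ k < suc n ] h (suc k)
    ≈⟨ +-congˡ (∑-cong (suc n) λ k _ → pascal k) ⟩
  h 0 + ∑[ k < suc n ] (f k + g (suc k))
    ≈⟨ +-congˡ (∑-+ (suc n) f (g ∘ suc)) ⟩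
  h 0 + (∑< (suc n) f + ∑[ k < suc n ] g (suc k))
    ≈⟨ solve 3 (λ p q r → p :+ (q :+ r) := q :+ (p :+ r)) ≈-refl (h 0) (∑< (suc n) f) (∑< (suc n) (g ∘ suc)) ⟩
  ∑< (suc n) f + ∑< (suc (suc n)) g
    -- The extra term `k = suc n` of `g` carries `n C suc n`, which is 0.
    ≈⟨ +-congˡ (∑-extend g (ℕₚ.n≤1+n (suc n)) λ k n<k → vanish k n<k) ⟨
  ∑< (suc n) f + ∑< (suc n) g
    ≈⟨ +-congˡ (∑-cong (suc n) λ k k<1+n → *-congˡ {fromℕ (n C k)} (*-congˡ {a k}
         (reflexive (cong b (ℕₚ.+-∸-assoc 1 (ℕ.s≤s⁻¹ k<1+n)))))) ⟩
  (a ∘ suc ⋆ b) n + (a ⋆ (b ∘ suc)) n ∎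
  where
  f g h : ℕ → ℝ
  f k = fromℕ (n C k) * (a (suc k) * b (n ∸ k))
  g k = fromℕ (n C k) * (a k * b (suc n ∸ k))
  h k = fromℕ (suc n C k) * (a k * b (suc n ∸ k))
  pascal : ∀ k → h (suc k) ≈ f k + g (suc k)
  pascal k = ≈-trans
    (*-congʳ (≈-trans (reflexive (cong fromℕ (≡.sym (nCk+nC[k+1]≡[n+1]C[k+1] n k)))) (fromℕ-+ (n C k) (n C suc k))))
    (distribʳ _ _ _)
  vanish : ∀ k → n < k → g k ≈ 0ℝ
  vanish k n<k = ≈-trans (*-congʳ (reflexive (cong fromℕ (k>n⇒nCk≡0 n<k)))) (zeroˡ _)

-- By induction on `n` the two terms of the Leibniz rule change places. Both sequences vary in the
-- induction, since the rule shifts them.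
⋆-comm : ∀ n a b → (a ⋆ b) n ≈ (b ⋆ a) n
⋆-comm zero    a b = ≈-trans (⋆-zero a b) (≈-trans (*-comm _ _) (≈-sym (⋆-zero b a)))
⋆-comm (suc n) a b = begin
  (a ⋆ b) (suc n)                      ≈⟨ ⋆-suc a b n ⟩
  (a ∘ suc ⋆ b) n + (a ⋆ (b ∘ suc)) n  ≈⟨ +-cong (⋆-comm n (a ∘ suc) b) (⋆-comm n a (b ∘ suc)) ⟩
  (b ⋆ (a ∘ suc)) n + (b ∘ suc ⋆ a) n  ≈⟨ +-comm _ _ ⟩
  (b ∘ suc ⋆ a) n + (b ⋆ (a ∘ suc)) n  ≈⟨ ⋆-suc b a n ⟨
  (b ⋆ a) (suc n)                      ∎

⋆-congˡ : ∀ n {a a′} b → (∀ k → k ≤ n → a k ≈ a′ k) → (a ⋆ b) n ≈ (a′ ⋆ b) n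
⋆-congˡ n b a≈a′ = ∑-cong (suc n) λ k k<1+n → *-congˡ {fromℕ (n C k)} (*-congʳ {b (n ∸ k)} (a≈a′ k (ℕ.s≤s⁻¹ k<1+n)))

∑-⋆ : ∀ n m (c : ℕ → ℝ) (s : ℕ → ℕ → ℝ) b →
      ((λ k → ∑[ j < m ] (c j * s j k)) ⋆ b) n ≈ ∑[ j < m ] (c j * (s j ⋆ b) n)
∑-⋆ n m c s b = begin
  ∑[ k < suc n ] (fromℕ (n C k) * (∑[ j < m ] (c j * s j k) * b (n ∸ k)))
    ≈⟨ ∑-cong (suc n) (λ k _ → ≈-trans
         (solve 3 (λ p q r → p :* (q :* r) := p :* r :* q) ≈-refl (fromℕ (n C k)) (∑[ j < m ] (c j * s j k)) (b (n ∸ k)))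
         (≈-trans (*-∑ m _ (λ j → c j * s j k)) (∑-cong m λ j _ →
           solve 4 (λ p q r t → p :* q :* (r :* t) := r :* (p :* (t :* q))) ≈-refl
             (fromℕ (n C k)) (b (n ∸ k)) (c j) (s j k)))) ⟩
  ∑[ k < suc n ] (∑[ j < m ] (c j * (fromℕ (n C k) * (s j k * b (n ∸ k)))))
    ≈⟨ ∑-comm (suc n) m (λ k j → c j * ⋆-term (s j) b n k) ⟩
  ∑[ j < m ] (∑[ k < suc n ] (c j * (fromℕ (n C k) * (s j k * b (n ∸ k)))))
    ≈⟨ ∑-cong m (λ j _ → *-∑ (suc n) (c j) (⋆-term (s j) b n)) ⟨
  ∑[ j < m ] (c j * (s j ⋆ b) n) ∎

-- Exponential generating functions

egf : (ℕ → ℝ) → Series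
egf a k = a k * 1/! k

!-egf : ∀ a n → fromℕ (n !) * egf a n ≈ a n
!-egf a n = begin
  fromℕ (n !) * (a n * 1/! n)  ≈⟨ solve 3 (λ p q r → p :* (q :* r) := q :* (p :* r)) ≈-refl (fromℕ (n !)) (a n) (1/! n) ⟩
  a n * (fromℕ (n !) * 1/! n)  ≈⟨ *-congˡ (!-1/! n) ⟩
  a n * 1ℝ                     ≈⟨ *-identityʳ _ ⟩
  a n                          ∎

-- Writing `n !` as `n C k` times `k !` times `(n ∸ k) !` lets the last two factors clear the
-- denominators of the two coefficients.
!-egf-⊛ : ∀ a b n → fromℕ (n !) * (egf a ⊛ egf b) n ≈ (a ⋆ b) n
!-egf-⊛ a b n = ≈-trans (*-∑ (suc n) _ λ k → egf a k * egf b (n ∸ k)) (∑-cong (suc n) λ k k<1+n → term k (ℕ.s≤s⁻¹ k<1+n))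
  where
  term : ∀ k → k ≤ n → fromℕ (n !) * (egf a k * egf b (n ∸ k)) ≈ fromℕ (n C k) * (a k * b (n ∸ k))
  term k k≤n = begin
    fromℕ (n !) * (egf a k * egf b (n ∸ k))
      ≈⟨ *-congʳ (≈-trans (reflexive (cong fromℕ (!≡C*!*! k≤n)))
           (≈-trans (fromℕ-* (n C k) _) (*-congˡ (fromℕ-* (k !) ((n ∸ k) !))))) ⟩
    fromℕ (n C k) * (fromℕ (k !) * fromℕ ((n ∸ k) !)) * (egf a k * egf b (n ∸ k))
      ≈⟨ solve 5 (λ p q r s t → p :* (q :* r) :* (s :* t) := p :* ((q :* s) :* (r :* t))) ≈-refl
           (fromℕ (n C k)) (fromℕ (k !)) (fromℕ ((n ∸ k) !)) (egf a k) (egf b (n ∸ k)) ⟩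
    fromℕ (n C k) * ((fromℕ (k !) * egf a k) * (fromℕ ((n ∸ k) !) * egf b (n ∸ k)))
      ≈⟨ *-congˡ (*-cong (!-egf a k) (!-egf b (n ∸ k))) ⟩
    fromℕ (n C k) * (a k * b (n ∸ k)) ∎

-- Formal power series

⊛-congˡ : ∀ {f f′} g n → (∀ k → f k ≈ f′ k) → (f ⊛ g) n ≈ (f′ ⊛ g) n
⊛-congˡ g n f≈f′ = ∑-cong (suc n) λ k _ → *-congʳ {g (n ∸ k)} (f≈f′ k)

1ˢ-⊛ : ∀ g n → (1ˢ ⊛ g) n ≈ g n
1ˢ-⊛ g n = ≈-trans (+-cong (*-identityˡ (g n)) (∑-zero n λ k _ → zeroˡ (g (n ∸ suc k)))) (+-identityʳ _)

⊖-⊛ : ∀ f f′ g n → ((f ⊖ f′) ⊛ g) n + (f′ ⊛ g) n ≈ (f ⊛ g) n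
⊖-⊛ f f′ g n = ≈-trans (≈-sym (∑-+ (suc n) (λ k → (f ⊖ f′) k * g (n ∸ k)) (λ k → f′ k * g (n ∸ k)))) (∑-cong (suc n) λ k _ →
  ≈-trans (≈-sym (distribʳ (g (n ∸ k)) _ _)) (*-congʳ (Additive.//-rightDividesˡ (f′ k) (f k))))

-- In degree `n`, every term other than `u 0 * r n` involves `r` at a smaller index. Strong
-- induction makes those terms agree; they cancel, and then so does the unit `u 0`.
reciprocal-unique : ∀ u r → u 0 ≈ 1ℝ → (∀ n → (u ⊛ r) n ≈ 1ˢ n) → ∀ n → r n ≈ reciprocal u n
reciprocal-unique u r u₀ ur≈1 = <-rec (λ n → r n ≈ reciprocal u n) λ n rec →
  cancel-unit (≈-trans (*-identityʳ _) u₀) (Additive.∙-cancelʳ _ _ _ (begin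
    u 0 * r n + ∑[ k < n ] (u (suc k) * r (n ∸ suc k))
      ≈⟨ ur≈1 n ⟩
    1ˢ n
      ≈⟨ reciprocal-inverse u u₀ n ⟨
    u 0 * reciprocal u n + ∑[ k < n ] (u (suc k) * reciprocal u (n ∸ suc k))
      ≈⟨ +-congˡ (∑-cong n λ k k<n → *-congˡ {u (suc k)}
           (rec (ℕₚ.∸-monoʳ-< {o = 0} z<s k<n))) ⟨
    u 0 * reciprocal u n + ∑[ k < n ] (u (suc k) * r (n ∸ suc k)) ∎))

-- Since `f 0` vanishes, coefficient `suc n` of the product with `f` is coefficient `n` of the
-- product with `f ∘ suc`.
t-over-unique : ∀ f r → f 0 ≈ 0ℝ → f 1 ≈ 1ℝ → (∀ n → (f ⊛ r) n ≈ tˢ n) → ∀ n → r n ≈ t-over f n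
t-over-unique f r f₀ f₁ fr≈t = reciprocal-unique (f ∘ suc) r f₁ λ n → begin
  (f ∘ suc ⊛ r) n                      ≈⟨ +-identityˡ _ ⟨
  0ℝ + (f ∘ suc ⊛ r) n                 ≈⟨ +-congʳ (≈-trans (*-congʳ f₀) (zeroˡ _)) ⟨
  f 0 * r (suc n) + (f ∘ suc ⊛ r) n    ≈⟨ fr≈t (suc n) ⟩
  tˢ (suc n)                           ≈⟨ shift n ⟩
  1ˢ n                                 ∎
  where
  shift : ∀ n → tˢ (suc n) ≈ 1ˢ n
  shift zero    = ≈-refl
  shift (suc n) = ≈-refl

-- Falling factorials

0⟦suc⟧ : ∀ k → 0ℝ ⟦ suc k ⟧ ≈ 0ℝ
0⟦suc⟧ zero    = ≈-trans (*-identityˡ _) (-‿inverseʳ 0ℝ)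
0⟦suc⟧ (suc k) = ≈-trans (*-congʳ (0⟦suc⟧ k)) (zeroˡ _)

-- The definition peels off the last factor of a falling factorial; this peels off the first.
⟦suc⟧-shift : ∀ y k → (1ℝ + y) ⟦ suc k ⟧ ≈ (1ℝ + y) * y ⟦ k ⟧
⟦suc⟧-shift y zero    = ≈-trans (*-identityˡ _) (≈-trans (minus-zero y ≈-refl) (≈-sym (*-identityʳ _)))
⟦suc⟧-shift y (suc k) = ≈-trans (*-cong (⟦suc⟧-shift y k) ([x+y]-[x+z]≈y-z 1ℝ y (fromℕ k))) (*-assoc _ _ _)

-- Evaluation at 0 isolates the coefficient of index 0. At `suc m`, the remaining terms share the
-- invertible factor `suc m`, and dividing by it leaves the same problem for the shifted
-- coefficients at `m`.
falling-unique : ∀ n (a b : ℕ → ℝ) →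
  (∀ m → ∑[ k < n ] (a k * fromℕ m ⟦ k ⟧) ≈ ∑[ k < n ] (b k * fromℕ m ⟦ k ⟧)) →
  ∀ k → k < n → a k ≈ b k
falling-unique (suc n) a b eq = λ where
    zero    _         → head
    (suc k) (s≤s k<n) → falling-unique n (a ∘ suc) (b ∘ suc) tail k k<n
  where
  at-0 : ∀ (d : ℕ → ℝ) → ∑[ k < suc n ] (d k * fromℕ 0 ⟦ k ⟧) ≈ d 0
  at-0 d = ≈-trans (+-cong (*-identityʳ _) (∑-zero n λ k _ → ≈-trans (*-congˡ {d (suc k)} (0⟦suc⟧ k)) (zeroʳ (d (suc k)))))
                   (+-identityʳ _)
  head : a 0 ≈ b 0
  head = ≈-trans (≈-sym (at-0 a)) (≈-trans (eq 0) (at-0 b))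
  at-suc : ∀ (d : ℕ → ℝ) m → ∑[ k < n ] (d (suc k) * fromℕ (suc m) ⟦ suc k ⟧)
                   ≈ fromℕ (suc m) * ∑[ k < n ] (d (suc k) * fromℕ m ⟦ k ⟧)
  at-suc d m = ≈-sym (≈-trans (*-∑ n _ λ k → d (suc k) * fromℕ m ⟦ k ⟧) (∑-cong n λ k _ → ≈-trans
    (solve 3 (λ p q r → p :* (q :* r) := q :* (p :* r)) ≈-refl (fromℕ (suc m)) (d (suc k)) (fromℕ m ⟦ k ⟧))
    (*-congˡ {d (suc k)} (≈-sym (⟦suc⟧-shift (fromℕ m) k)))))
  tail : ∀ m → ∑[ k < n ] (a (suc k) * fromℕ m ⟦ k ⟧) ≈ ∑[ k < n ] (b (suc k) * fromℕ m ⟦ k ⟧)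
  tail m = cancel-unit (fromℕ-1/ℕ (suc m)) (≈-trans (≈-sym (at-suc a m)) (≈-trans
    (Additive.∙-cancelˡ _ _ _ (≈-trans (eq (suc m)) (+-congʳ (*-congʳ (≈-sym head)))))
    (at-suc b m)))

-- Each of the `k` factors absorbs one `x`: `x * (1ℝ - fromℕ i * μ)` equals `x - fromℕ i`.
^*⟦⟧≈⟦⟧ : ∀ {x μ} → x * μ ≈ 1ℝ → ∀ k → x ^ k * 1ℝ ⟦ k ∣ μ ⟧ ≈ x ⟦ k ⟧
^*⟦⟧≈⟦⟧ xμ≈1 zero = *-identityʳ _
^*⟦⟧≈⟦⟧ {x} {μ} xμ≈1 (suc k) = begin
  x * x ^ k * (1ℝ ⟦ k ∣ μ ⟧ * (1ℝ - fromℕ k * μ))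
    ≈⟨ solve 4 (λ x p q r → x :* p :* (q :* r) := p :* q :* (x :* r)) ≈-refl x (x ^ k) (1ℝ ⟦ k ∣ μ ⟧) (1ℝ - fromℕ k * μ) ⟩
  x ^ k * 1ℝ ⟦ k ∣ μ ⟧ * (x * (1ℝ - fromℕ k * μ))
    ≈⟨ *-cong (^*⟦⟧≈⟦⟧ xμ≈1 k) (≈-trans (Ringₚ.x[y-z]≈xy-xz x 1ℝ _) (+-cong (*-identityʳ x) (-‿cong cancel))) ⟩
  x ⟦ k ⟧ * (x - fromℕ k) ∎
  where
  cancel : x * (fromℕ k * μ) ≈ fromℕ k
  cancel = begin
    x * (fromℕ k * μ)  ≈⟨ solve 3 (λ x p q → x :* (p :* q) := p :* (x :* q)) ≈-refl x (fromℕ k) μ ⟩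
    fromℕ k * (x * μ)  ≈⟨ *-congˡ xμ≈1 ⟩
    fromℕ k * 1ℝ       ≈⟨ *-identityʳ _ ⟩
    fromℕ k            ∎

-- That is, e_x^x(t) = 1 + x t.
x⟦n∣x⟧≈ : ∀ x n → x ⟦ n ∣ x ⟧ ≈ 1ˢ n + x * tˢ n
x⟦n∣x⟧≈ x zero          = solve 1 (λ x → con 1 := con 1 :+ x :* con 0) ≈-refl x
x⟦n∣x⟧≈ x (suc zero)    = ≈-trans (*-identityˡ _) (≈-trans (x-0*y≈x x x)
  (solve 1 (λ x → x := con 0 :+ x :* con 1) ≈-refl x))
x⟦n∣x⟧≈ x (suc (suc n)) = ≈-trans (vanish n) (solve 1 (λ x → con 0 := con 0 :+ x :* con 0) ≈-refl x)
  where
  vanish : ∀ n → x ⟦ suc (suc n) ∣ x ⟧ ≈ 0ℝ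
  vanish zero    = ≈-trans (*-congˡ (≈-trans
    (+-congˡ (-‿cong (solve 1 (λ x → (con 1 :+ con 0) :* x := x) ≈-refl x))) (-‿inverseʳ x))) (zeroʳ _)
  vanish (suc n) = ≈-trans (*-congʳ (vanish n)) (zeroˡ _)

-- Degenerate Stirling numbers

-- Both arrays expand the same value at every natural argument, so `falling-unique` applies. The
-- definition constrains only entries with `k ≤ n`, hence the bound.
stirling₂-unique : ∀ {ƛ S₂} → IsDegenerateStirling₂ ƛ S₂ → ∀ {n k} → k ≤ n → S₂ n k ≈ stirling₂ ƛ n k
stirling₂-unique {ƛ} {S₂} isS {n} {k} k≤n = falling-unique (suc n) (S₂ n) (stirling₂ ƛ n)
  (λ m → ≈-trans (≈-sym (isS n (fromℕ m))) (stirling₂-isDegenerateStirling₂ ƛ n (fromℕ m))) k (s≤s k≤n)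

module Stirling (ƛ : ℝ) where

  S : ℕ → ℕ → ℝ
  S = stirling₂ ƛ

  one : ℕ → ℝ
  one k = 1ℝ ⟦ k ∣ ƛ ⟧

  S-zeroʳ : ∀ n → S n 0 ≈ 1ˢ n
  S-zeroʳ zero          = ≈-refl
  S-zeroʳ (suc zero)    = ≈-trans (*-identityˡ _) (x-0*y≈x 0ℝ ƛ)
  S-zeroʳ (suc (suc n)) = ≈-trans (*-congʳ (S-zeroʳ (suc n))) (zeroˡ _)

  -- The entry in column `j - 1`, set to 0 for `j = 0` so that the recurrence `S-suc` has one form
  -- for all `j`.
  S⁻ : ℕ → ℕ → ℝ
  S⁻ n zero    = 0ℝ
  S⁻ n (suc j) = S n j

  S-suc : ∀ n j → S (suc n) j ≈ S⁻ n j + S n j * (fromℕ j - fromℕ n * ƛ)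
  S-suc n zero    = ≈-sym (+-identityˡ _)
  S-suc n (suc j) = ≈-refl

  -- The Leibniz rule raises either `one k`, with weight `1 - k ƛ`, or `S l j`, with weight
  -- `j - l ƛ`. As `k + l = n`, the weights add up to `j + 1 - n ƛ`, which is independent of `k` and
  -- leaves the sum.
  one-⋆-S-suc : ∀ n j → (one ⋆ (λ k → S k j)) (suc n) ≈
    (one ⋆ (λ k → S⁻ k j)) n + (fromℕ (suc j) - fromℕ n * ƛ) * (one ⋆ (λ k → S k j)) n
  one-⋆-S-suc n j = begin
    (one ⋆ s) (suc n)
      ≈⟨ ⋆-suc one s n ⟩
    (one ∘ suc ⋆ s) n + (one ⋆ (s ∘ suc)) n
      ≈⟨ ∑-+ (suc n) (⋆-term (one ∘ suc) s n) (⋆-term one (s ∘ suc) n) ⟨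
    ∑[ k < suc n ] (fromℕ (n C k) * (one (suc k) * s (n ∸ k)) + fromℕ (n C k) * (one k * s (suc (n ∸ k))))
      ≈⟨ ∑-cong (suc n) (λ k k<1+n → term k (ℕ.s≤s⁻¹ k<1+n)) ⟩
    ∑[ k < suc n ] (fromℕ (n C k) * (one k * S⁻ (n ∸ k) j) + w * (fromℕ (n C k) * (one k * s (n ∸ k))))
      ≈⟨ ∑-+ (suc n) (⋆-term one (λ k → S⁻ k j) n) (λ k → w * ⋆-term one s n k) ⟩
    (one ⋆ (λ k → S⁻ k j)) n + ∑[ k < suc n ] (w * ⋆-term one s n k)
      ≈⟨ +-congˡ (*-∑ (suc n) w (⋆-term one s n)) ⟨
    (one ⋆ (λ k → S⁻ k j)) n + w * (one ⋆ s) n ∎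
    where
    s : ℕ → ℝ
    s k = S k j
    w : ℝ
    w = fromℕ (suc j) - fromℕ n * ƛ
    weight : ∀ {k} → k ≤ n → - (fromℕ k * ƛ) + - (fromℕ (n ∸ k) * ƛ) ≈ - (fromℕ n * ƛ)
    weight {k} k≤n = begin
      - (fromℕ k * ƛ) + - (fromℕ (n ∸ k) * ƛ)  ≈⟨ Additive.⁻¹-∙-comm _ _ ⟩
      - (fromℕ k * ƛ + fromℕ (n ∸ k) * ƛ)      ≈⟨ -‿cong (distribʳ ƛ _ _) ⟨
      - ((fromℕ k + fromℕ (n ∸ k)) * ƛ)        ≈⟨ -‿cong (*-congʳ (fromℕ-+ k (n ∸ k))) ⟨
      - (fromℕ (k ℕ.+ (n ∸ k)) * ƛ)            ≈⟨ -‿cong (*-congʳ (reflexive (cong fromℕ (ℕₚ.m+[n∸m]≡n k≤n)))) ⟩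
      - (fromℕ n * ƛ)                          ∎
    term : ∀ k → k ≤ n →
      fromℕ (n C k) * (one (suc k) * s (n ∸ k)) + fromℕ (n C k) * (one k * s (suc (n ∸ k))) ≈
      fromℕ (n C k) * (one k * S⁻ (n ∸ k) j) + w * (fromℕ (n C k) * (one k * s (n ∸ k)))
    term k k≤n = begin
      c * (o * (1ℝ + x) * s l) + c * (o * s (suc l))
        ≈⟨ +-congˡ (*-congˡ (*-congˡ (S-suc l j))) ⟩
      c * (o * (1ℝ + x) * s l) + c * (o * (S⁻ l j + s l * (fromℕ j + y)))
        ≈⟨ solve 7 (λ c o x y s p j →
             c :* (o :* (con 1 :+ x) :* s) :+ c :* (o :* (p :+ s :* (j :+ y)))
             := c :* (o :* p) :+ (con 1 :+ j :+ (x :+ y)) :* (c :* (o :* s)))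
             ≈-refl c o x y (s l) (S⁻ l j) (fromℕ j) ⟩
      c * (o * S⁻ l j) + (fromℕ (suc j) + (x + y)) * (c * (o * s l))
        ≈⟨ +-congˡ (*-congʳ (+-congˡ (weight k≤n))) ⟩
      c * (o * S⁻ l j) + w * (c * (o * s l)) ∎
      where
      l : ℕ
      l = n ∸ k
      c o x y : ℝ
      c = fromℕ (n C k)
      o = one k
      x = - (fromℕ k * ƛ)
      y = - (fromℕ l * ƛ)

  -- Both sides are the coefficient of `(y)_j` in `(1 + y)_{n,ƛ}`. The induction on `n` treats all
  -- `j` together, because `one-⋆-S-suc` refers to column `j - 1`.
  one-⋆-S : ∀ n j → (one ⋆ (λ k → S k j)) n ≈ S n j + fromℕ (suc j) * S n (suc j)
  one-⋆-S zero j = begin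
    (one ⋆ (λ k → S k j)) 0            ≈⟨ ⋆-zero one (λ k → S k j) ⟩
    1ℝ * S 0 j                         ≈⟨ solve 2 (λ s p → con 1 :* s := s :+ p :* con 0) ≈-refl (S 0 j) (fromℕ (suc j)) ⟩
    S 0 j + fromℕ (suc j) * S 0 (suc j) ∎
  one-⋆-S (suc n) j = begin
    (one ⋆ (λ k → S k j)) (suc n)
      ≈⟨ one-⋆-S-suc n j ⟩
    (one ⋆ (λ k → S⁻ k j)) n + (fromℕ (suc j) - fromℕ n * ƛ) * (one ⋆ (λ k → S k j)) n
      ≈⟨ +-cong (one-⋆-S⁻ j) (*-congˡ (one-⋆-S n j)) ⟩
    (S⁻ n j + fromℕ j * S n j) + (fromℕ (suc j) + m) * (S n j + fromℕ (suc j) * S n (suc j))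
      -- The solver works in a commutative semiring, so the negative term stays an atom `m`;
      -- `S (suc n) (suc j)` unfolds by definition.
      ≈⟨ solve 5 (λ p s s′ j m → (p :+ j :* s) :+ (con 1 :+ j :+ m) :* (s :+ (con 1 :+ j) :* s′)
           := (p :+ s :* (j :+ m)) :+ (con 1 :+ j) :* (s :+ s′ :* (con 1 :+ j :+ m)))
           ≈-refl (S⁻ n j) (S n j) (S n (suc j)) (fromℕ j) m ⟩
    (S⁻ n j + S n j * (fromℕ j + m)) + fromℕ (suc j) * S (suc n) (suc j)
      ≈⟨ +-congʳ (S-suc n j) ⟨
    S (suc n) j + fromℕ (suc j) * S (suc n) (suc j) ∎
    where
    m : ℝ
    m = - (fromℕ n * ƛ)
    one-⋆-S⁻ : ∀ j → (one ⋆ (λ k → S⁻ k j)) n ≈ S⁻ n j + fromℕ j * S n j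
    one-⋆-S⁻ zero    = ≈-trans
      (∑-zero (suc n) λ k _ → ≈-trans (*-congˡ {fromℕ (n C k)} (zeroʳ (one k))) (zeroʳ _))
      (solve 1 (λ s → con 0 := con 0 :+ con 0 :* s) ≈-refl (S n 0))
    one-⋆-S⁻ (suc j) = one-⋆-S n j

-- Degenerate Bernoulli numbers

module Bernoulli (ƛ : ℝ) (ƛ#0 : ƛ # 0ℝ) where
  open Stirling ƛ

  c : ℕ → ℝ
  c j = ƛ ^ j * 1ℝ ⟦ suc j ∣ inv ƛ ƛ#0 ⟧ * 1/ℕ (suc j)

  ƛ*c : ∀ j → ƛ * (c j * fromℕ (suc j)) ≈ ƛ ⟦ suc j ⟧
  ƛ*c j = begin
    ƛ * (ƛ ^ j * p * q * r)
      ≈⟨ solve 5 (λ l m p q r → l :* (m :* p :* q :* r) := l :* m :* p :* (r :* q)) ≈-refl ƛ (ƛ ^ j) p q r ⟩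
    ƛ * ƛ ^ j * p * (r * q)
      -- `ƛ * ƛ ^ j` is `ƛ ^ suc j`, one power for each factor of `p`.
      ≈⟨ *-cong (^*⟦⟧≈⟦⟧ (inv-inverseʳ ƛ ƛ#0) (suc j)) (fromℕ-1/ℕ (suc j)) ⟩
    ƛ ⟦ suc j ⟧ * 1ℝ
      ≈⟨ *-identityʳ _ ⟩
    ƛ ⟦ suc j ⟧ ∎
    where
    p q r : ℝ
    p = 1ℝ ⟦ suc j ∣ inv ƛ ƛ#0 ⟧
    q = 1/ℕ (suc j)
    r = fromℕ (suc j)

  -- The value of `L` at `(y)_{k,ƛ}`; by `egf-b≈t-over` it is the degenerate Bernoulli number
  -- `β_{k,ƛ}(0)`.
  b : ℕ → ℝ
  b k = ∑[ j < suc k ] (c j * S k j)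

  -- A range of `j` common to all `k ≤ n` allows the two summations to be exchanged in `b-⋆`.
  b-extend : ∀ {k n} → k ≤ n → b k ≈ ∑[ j < suc n ] (c j * S k j)
  b-extend {k} k≤n = ∑-extend (λ j → c j * S k j) (s≤s k≤n) λ j k<j →
    ≈-trans (*-congˡ (stirling₂-zero ƛ k j k<j)) (zeroʳ _)

  b-⋆ : ∀ a n → (b ⋆ a) n ≈ ∑[ j < suc n ] (c j * ((λ k → S k j) ⋆ a) n)
  b-⋆ a n = ≈-trans (⋆-congˡ n a λ k k≤n → b-extend k≤n) (∑-⋆ n (suc n) c (λ j k → S k j) a)

  -- This is `ƛ L(Δ p) = p(ƛ) - p(0)` for `p = (y)_{n,ƛ}`, where `p(0)` is `1ˢ n`; the factor `ƛ` is
  -- cancelled at the end.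
  ∑-difference : ∀ n → ∑[ j < suc n ] (c j * fromℕ (suc j) * S n (suc j)) ≈ tˢ n
  ∑-difference n = cancel-unit (inv-inverseʳ ƛ ƛ#0) (Additive.∙-cancelˡ (1ˢ n) _ _ (begin
    1ˢ n + ƛ * ∑[ j < suc n ] (c j * fromℕ (suc j) * S n (suc j))
      -- `1ˢ n` becomes the term `k = 0`, and the summand at `j` becomes the term `k = suc j`.
      ≈⟨ +-cong (≈-sym (≈-trans (*-identityʳ _) (S-zeroʳ n))) (≈-trans (*-∑ (suc n) ƛ (λ j → c j * fromℕ (suc j) * S n (suc j))) (∑-cong (suc n) λ j _ → term j)) ⟩
    ∑[ k < suc (suc n) ] (S n k * ƛ ⟦ k ⟧)
      ≈⟨ ∑-extend (λ k → S n k * ƛ ⟦ k ⟧) (ℕₚ.n≤1+n (suc n)) (λ k n<k →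
           ≈-trans (*-congʳ (stirling₂-zero ƛ n k n<k)) (zeroˡ _)) ⟨
    ∑[ k < suc n ] (S n k * ƛ ⟦ k ⟧)
      ≈⟨ stirling₂-isDegenerateStirling₂ ƛ n ƛ ⟨
    ƛ ⟦ n ∣ ƛ ⟧
      ≈⟨ x⟦n∣x⟧≈ ƛ n ⟩
    1ˢ n + ƛ * tˢ n ∎))
    where
    term : ∀ j → ƛ * (c j * fromℕ (suc j) * S n (suc j)) ≈ S n (suc j) * ƛ ⟦ suc j ⟧
    term j = ≈-trans (≈-sym (*-assoc _ _ _)) (≈-trans (*-congʳ (ƛ*c j)) (*-comm _ _))

  -- The coefficient form of `e_ƛ(t) B(t) = t + B(t)`. Commuting the factors lets `b-⋆` expand `b`,
  -- and `one-⋆-S` then separates the difference from `b n`.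
  one-⋆-b : ∀ n → (one ⋆ b) n ≈ tˢ n + b n
  one-⋆-b n = begin
    (one ⋆ b) n
      ≈⟨ ⋆-comm n one b ⟩
    (b ⋆ one) n
      ≈⟨ b-⋆ one n ⟩
    ∑[ j < suc n ] (c j * ((λ k → S k j) ⋆ one) n)
      ≈⟨ ∑-cong (suc n) (λ j _ → ≈-trans
           (*-congˡ {c j} (≈-trans (⋆-comm n (λ k → S k j) one) (one-⋆-S n j)))
           (solve 4 (λ p s q s′ → p :* (s :+ q :* s′) := p :* q :* s′ :+ p :* s)
             ≈-refl (c j) (S n j) (fromℕ (suc j)) (S n (suc j)))) ⟩
    ∑[ j < suc n ] (c j * fromℕ (suc j) * S n (suc j) + c j * S n j)
      ≈⟨ ∑-+ (suc n) (λ j → c j * fromℕ (suc j) * S n (suc j)) (λ j → c j * S n j) ⟩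
    ∑[ j < suc n ] (c j * fromℕ (suc j) * S n (suc j)) + b n
      ≈⟨ +-congʳ (∑-difference n) ⟩
    tˢ n + b n ∎

  e-1 : Series
  e-1 = e ƛ 1ℝ ⊖ 1ˢ

  e-1-⊛-egf-b : ∀ n → (e-1 ⊛ egf b) n ≈ tˢ n
  e-1-⊛-egf-b n = cancel-unit (!-1/! n) (Additive.∙-cancelʳ (b n) _ _ (begin
    fromℕ (n !) * (e-1 ⊛ egf b) n + b n
      ≈⟨ +-congˡ (≈-trans (*-congˡ (1ˢ-⊛ (egf b) n)) (!-egf b n)) ⟨
    fromℕ (n !) * (e-1 ⊛ egf b) n + fromℕ (n !) * (1ˢ ⊛ egf b) n
      ≈⟨ distribˡ _ _ _ ⟨
    fromℕ (n !) * ((e-1 ⊛ egf b) n + (1ˢ ⊛ egf b) n)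
      ≈⟨ *-congˡ (⊖-⊛ (e ƛ 1ℝ) 1ˢ (egf b) n) ⟩
    -- `e ƛ 1ℝ` is `egf one` by definition.
    fromℕ (n !) * (egf one ⊛ egf b) n
      ≈⟨ !-egf-⊛ one b n ⟩
    (one ⋆ b) n
      ≈⟨ one-⋆-b n ⟩
    tˢ n + b n
      -- `tˢ` lives in degree 1, where the factorial is 1.
      ≈⟨ +-congʳ (!*tˢ n) ⟨
    fromℕ (n !) * tˢ n + b n ∎))
    where
    !*tˢ : ∀ n → fromℕ (n !) * tˢ n ≈ tˢ n
    !*tˢ zero          = zeroʳ _
    !*tˢ (suc zero)    = ≈-trans (*-identityʳ _) (+-identityʳ 1ℝ)
    !*tˢ (suc (suc n)) = zeroʳ _

  egf-b≈t-over : ∀ n → egf b n ≈ t-over e-1 n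
  egf-b≈t-over = t-over-unique e-1 (egf b)
    (≈-trans (+-congʳ (*-identityˡ 1ℝ)) (-‿inverseʳ 1ℝ))
    (≈-trans (minus-zero ƛ ≈-refl) (≈-trans (*-identityʳ _) (≈-trans (*-identityˡ _) (x-0*y≈x 1ℝ ƛ))))
    e-1-⊛-egf-b

  β≈b-⋆ : ∀ n x → β ƛ n x ≈ (b ⋆ (λ k → x ⟦ k ∣ ƛ ⟧)) n
  β≈b-⋆ n x = ≈-trans (*-congˡ (⊛-congˡ (e ƛ x) n λ k → ≈-sym (egf-b≈t-over k)))
                      (!-egf-⊛ b (λ k → x ⟦ k ∣ ƛ ⟧) n)

-- From the binomial convolution to the double sum

theorem5 : (ƛ : ℝ) (ƛ#0 : ƛ # 0ℝ) (S₂ : ℕ → ℕ → ℝ) → IsDegenerateStirling₂ ƛ S₂ →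
    (x : ℝ) (n : ℕ) →
    β ƛ n x ≈ ∑[ j from 0 to n ]
    ((ƛ ^ j * 1ℝ ⟦ suc j ∣ inv ƛ ƛ#0 ⟧ * 1/ℕ (suc j)) *
    (∑[ k from j to n ] (fromℕ (n C k) * S₂ k j * x ⟦ n ∸ k ∣ ƛ ⟧)))
theorem5 ƛ ƛ#0 S₂ isS x n = begin
  β ƛ n x
    ≈⟨ β≈b-⋆ n x ⟩
  (b ⋆ y) n
    ≈⟨ b-⋆ y n ⟩
  ∑[ j < suc n ] (c j * ((λ k → S k j) ⋆ y) n)
    ≈⟨ ∑-cong (suc n) (λ j _ → *-congˡ {c j} (inner j)) ⟩
  ∑[ j < suc n ] (c j * (∑[ k from j to n ] (fromℕ (n C k) * S₂ k j * y (n ∸ k)))) ∎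
  where
  open Stirling ƛ
  open Bernoulli ƛ ƛ#0
  y : ℕ → ℝ
  y k = x ⟦ k ∣ ƛ ⟧
  inner : ∀ j → ((λ k → S k j) ⋆ y) n ≈ ∑[ k from j to n ] (fromℕ (n C k) * S₂ k j * y (n ∸ k))
  inner j = begin
    ((λ k → S k j) ⋆ y) n
      -- Terms with `k < j` vanish with `S k j`, so the sum may start at `j`.
      ≈⟨ ∑-drop j (suc n) (⋆-term (λ k → S k j) y n) (λ k k<j → ≈-trans (*-congˡ {fromℕ (n C k)}
           (≈-trans (*-congʳ (stirling₂-zero ƛ k j k<j)) (zeroˡ _))) (zeroʳ _)) ⟨
    ∑[ i < suc n ∸ j ] (fromℕ (n C (j ℕ.+ i)) * (S (j ℕ.+ i) j * y (n ∸ (j ℕ.+ i))))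
      -- Now `k = j + i` is at least `j`, where `S₂` is determined.
      ≈⟨ ∑-cong (suc n ∸ j) (λ i _ → ≈-trans (≈-sym (*-assoc _ _ (y (n ∸ (j ℕ.+ i)))))
           (*-congʳ (*-congˡ {fromℕ (n C (j ℕ.+ i))} (≈-sym (stirling₂-unique {S₂ = S₂} isS (ℕₚ.m≤m+n j i)))))) ⟩
    ∑[ k from j to n ] (fromℕ (n C k) * S₂ k j * y (n ∸ k)) ∎
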